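{- Let $G=(V,E)$ be a finite Eulerian graph (every vertex has even degree). For $\underline{r}=(r_v)_{v\in V}\in\mathbb{Z}^V$ let $\varepsilon_{\underline{r}}(G)$ be the number of orientations of $G$ in which every vertex $v$ has in-degree exactly $r_v$. Then $\varepsilon_{\underline{r}}(G)$ is maximal (over all $\underline{r}\in\mathbb{Z}^V$) when $r_v=d_G(v)/2$ for every vertex $v$; that is, $\varepsilon_{\underline{r}}(G)\leq \varepsilon(G)$ for every $\underline{r}\in\mathbb{Z}^V$, where $\varepsilon(G)$ is the number of Eulerian orientations of $G$.
   Context: An Eulerian orientation is an orientation in which every vertex has in-degree equal to out-degree, i.e. in-degree $d_G(v)/2$ at each vertex $v$. -}

module Defs where

open import Data.Bool using (Bool; true; false; if_then_else_)
open import Data.Fin using (Fin; _≟_)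
open import Data.Fin.Properties using (all?)
open import Data.Integer using (ℤ; +_)
import Data.Integer as ℤ
open import Data.List using (List; []; _∷_; length; filter; allFin; cartesianProductWith)
open import Data.List.Membership.Propositional using (_∈_)
open import Data.List.Membership.Propositional.Properties using (∈-cartesianProductWith⁺)
open import Data.List.Relation.Unary.All using ([]; _∷_)
open import Data.List.Relation.Unary.AllPairs using ([]; _∷_)
open import Data.List.Relation.Unary.Any using (here; there)
open import Data.List.Relation.Unary.Unique.Propositional using (Unique)
open import Data.List.Relation.Unary.Unique.Propositional.Properties using (cartesianProductWith⁺)
open import Data.Nat using (ℕ; zero; suc; _+_; _/_)
import Data.Nat as ℕ
open import Data.Nat.Divisibility using (_∣_)
open import Data.Product using (_×_; proj₁; proj₂)
open import Data.Vec using (Vec; []; _∷_; lookup)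
open import Data.Vec.Properties using (∷-injective)
open import Relation.Binary.PropositionalEquality using (_≡_; refl)
open import Relation.Unary using (Decidable)

-- A finite undirected graph; parallel edges and loops are allowed.  The order
-- in which the two ends of an edge are listed is an arbitrary labelling.
record Graph : Set where
  field
    #V   : ℕ
    #E   : ℕ
    ends : Fin #E → Fin #V × Fin #V

  V : Set
  V = Fin #V

  E : Set
  E = Fin #E

allBoolVecs : ∀ m → List (Vec Bool m)
allBoolVecs zero    = [] ∷ []
allBoolVecs (suc m) = cartesianProductWith _∷_ (false ∷ true ∷ []) (allBoolVecs m)

allBoolVecs-complete : ∀ {m} (w : Vec Bool m) → w ∈ allBoolVecs m
allBoolVecs-complete []      = here refl
allBoolVecs-complete (b ∷ w) = ∈-cartesianProductWith⁺ _∷_ (mem b) (allBoolVecs-complete w)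
  where
  mem : ∀ b → b ∈ (false ∷ true ∷ [])
  mem false = here refl
  mem true  = there (here refl)

allBoolVecs-unique : ∀ m → Unique (allBoolVecs m)
allBoolVecs-unique zero    = [] ∷ []
allBoolVecs-unique (suc m) =
  cartesianProductWith⁺ _∷_ ∷-injective (((λ ()) ∷ []) ∷ ([] ∷ [])) (allBoolVecs-unique m)

module _ (G : Graph) where
  open Graph G

  #edges : (f : E → V) → V → ℕ
  #edges f v = length (filter (λ e → f e ≟ v) (allFin #E))

  -- Counts incident edge-ends, so a loop contributes 2.
  degree : V → ℕ
  degree v = #edges (λ e → proj₁ (ends e)) v + #edges (λ e → proj₂ (ends e)) v

  IsEulerian : Set
  IsEulerian = ∀ v → 2 ∣ degree v

  -- The bit at e is true when e is directed from its first to its second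
  -- listed end, and false when it is directed the other way.  In particular a
  -- loop has two orientations, each adding 1 to both in- and out-degree.
  Orientation : Set
  Orientation = Vec Bool #E

  head tail : Orientation → E → V
  head o e = if lookup o e then proj₂ (ends e) else proj₁ (ends e)
  tail o e = if lookup o e then proj₁ (ends e) else proj₂ (ends e)

  inDegree outDegree : Orientation → V → ℕ
  inDegree  o = #edges (head o)
  outDegree o = #edges (tail o)

  #orientations : ∀ {P : Orientation → Set} → Decidable P → ℕ
  #orientations P? = length (filter P? (allBoolVecs #E))

  HasInDegrees : (V → ℤ) → Orientation → Set
  HasInDegrees r o = ∀ v → + inDegree o v ≡ r v

  hasInDegrees? : ∀ r → Decidable (HasInDegrees r)
  hasInDegrees? r o = all? (λ v → + inDegree o v ℤ.≟ r v)

  IsEulerianOrientation : Orientation → Set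
  IsEulerianOrientation o = ∀ v → inDegree o v ≡ outDegree o v

  isEulerianOrientation? : Decidable IsEulerianOrientation
  isEulerianOrientation? o = all? (λ v → inDegree o v ℕ.≟ outDegree o v)

  εᵣ : (V → ℤ) → ℕ
  εᵣ r = #orientations (hasInDegrees? r)

  ε : ℕ
  ε = #orientations isEulerianOrientation?

  halfDegree : V → ℤ
  halfDegree v = + (degree v / 2)

{-# OPTIONS --safe #-}

-- Let N(L,s) be the number of orientations of the edge list L whose net inflow
-- (in-degree minus out-degree) is s.  Superposing two orientations and
-- separating the edges on which they agree from those on which they disagree
-- gives
--   N(L,s+t) · N(L,s-t) = Σ_{L = A ⊔ D} N(A,s) · N(D,t).
-- Put t = 0.  The term with D empty is N(L,s), so
--   N(L,s)² - N(L,s) = Σ_{L = A ⊔ D, D ≠ ∅} N(A,s) · N(D,0).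
-- If N(D,0) ≠ 0, then D, and hence A, has even degrees, so by induction on the
-- number of edges every term is largest at s = 0.  As x² - x is increasing on
-- x ≥ 1 and N(L,0) ≥ 1, this gives N(L,s) ≤ N(L,0).  Finally ε_r is N at
-- s = 2r - d.
module Submission where

open import Defs
open import Algebra.Properties.CommutativeSemigroup using (interchange; x∙yz≈y∙xz)
open import Data.Bool using (Bool; true; false; if_then_else_)
open import Data.Empty using (⊥-elim)
open import Data.Fin using (Fin; zero; suc; _≟_)
open import Data.Fin.Properties using (all?)
open import Data.Integer using (ℤ; +_; 0ℤ)
import Data.Integer as ℤ
open import Data.Integer.Divisibility.Signed using (_∣_; _∣?_; divides; ∣ᵤ⇒∣; ∣m∣n⇒∣m+n; ∣m+n∣m⇒∣n; ∣m+n∣n⇒∣m)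
import Data.Integer.Properties as ℤₚ
open import Data.Integer.Tactic.RingSolver using (solve-∀)
open import Data.List using (List; []; _∷_; _++_; length; filter; map; tabulate; allFin)
open import Data.List.Properties using (length-++; filter-++; filter-≐; map-tabulate; ++-identityʳ)
open import Data.List.Relation.Ternary.Interleaving.Propositional using (Interleaving; []; consˡ; consʳ)
open import Data.List.Relation.Ternary.Interleaving.Properties using (interleave-length)
open import Data.Nat using (ℕ; zero; suc; _+_; _*_; _≤_; _<_; z≤n; s≤s)
import Data.Nat.DivMod as ℕ
import Data.Nat.Properties as ℕₚ
import Data.Nat.Tactic.RingSolver as ℕ-Solver
open import Data.Product using (_×_; _,_; proj₁; proj₂; ∃₂)
open import Data.Sum using (_⊎_; inj₁; inj₂)
open import Data.Vec using (Vec; []; _∷_; lookup)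
open import Function using (_∘_; _⇔_; mk⇔)
open import Relation.Binary.PropositionalEquality
open import Relation.Nullary using (¬_; Dec; yes; no; does; _×-dec_)
open import Relation.Nullary.Decidable using (does-⇔; from-no; dec-true; dec-false)
open import Relation.Unary using (Decidable; _≐_)

-- Indicators of decidable propositions, and elementary arithmetic.

𝟙 : ∀ {P : Set} → Dec P → ℕ
𝟙 P? = if does P? then 1 else 0

𝟙-⇔ : ∀ {P Q : Set} → P ⇔ Q → (P? : Dec P) (Q? : Dec Q) → 𝟙 P? ≡ 𝟙 Q?
𝟙-⇔ P⇔Q P? Q? = cong (if_then 1 else 0) (does-⇔ P⇔Q P? Q?)

𝟙-true : ∀ {P : Set} (P? : Dec P) → P → 𝟙 P? ≡ 1
𝟙-true P? p = cong (if_then 1 else 0) (dec-true P? p)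

𝟙-false : ∀ {P : Set} (P? : Dec P) → ¬ P → 𝟙 P? ≡ 0
𝟙-false P? ¬p = cong (if_then 1 else 0) (dec-false P? ¬p)

𝟙-≢0 : ∀ {P : Set} (P? : Dec P) → 𝟙 P? ≢ 0 → P
𝟙-≢0 (yes p) _   = p
𝟙-≢0 (no _)  0≢0 = ⊥-elim (0≢0 refl)

𝟙-× : ∀ {P Q : Set} (P? : Dec P) (Q? : Dec Q) → 𝟙 (P? ×-dec Q?) ≡ 𝟙 P? * 𝟙 Q?
𝟙-× P? Q? with does P? | does Q?
... | false | _     = refl
... | true  | false = refl
... | true  | true  = refl

i+i≡0⇒i≡0 : ∀ i → i ℤ.+ i ≡ 0ℤ → i ≡ 0ℤ
i+i≡0⇒i≡0 i eq = ℤₚ.*-cancelʳ-≡ i 0ℤ (+ 2) (trans (double i) eq)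
  where
  double : ∀ i → i ℤ.* + 2 ≡ i ℤ.+ i
  double = solve-∀

m+n≢0⇒m≢0⊎n≢0 : ∀ m n → m + n ≢ 0 → m ≢ 0 ⊎ n ≢ 0
m+n≢0⇒m≢0⊎n≢0 zero    n n≢0 = inj₂ n≢0
m+n≢0⇒m≢0⊎n≢0 (suc m) n _   = inj₁ λ ()

-- Writing a positive number as `suc k`, its square minus itself is `k * suc k`, which is strictly
-- increasing in `k`. The bound `1 ≤ n` excludes `m = 1`, `n = 0`, where `p` and `q` both vanish.
m*m∸m-cancel-≤ : ∀ {m n p q} → 1 ≤ n → m * m ≡ m + p → n * n ≡ n + q → p ≤ q → m ≤ n
m*m∸m-cancel-≤ {zero}          _ _   _   _   = z≤n
m*m∸m-cancel-≤ {suc m} {suc n} {p} {q} _ m²≡ n²≡ p≤q =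
  ℕₚ.≮⇒≥ λ n<m → ℕₚ.<⇒≱ (strict n<m) (subst₂ _≤_ (sym (peel m m²≡)) (sym (peel n n²≡)) p≤q)
  where
  peel : ∀ k {r} → suc k * suc k ≡ suc k + r → k * suc k ≡ r
  peel k {r} = ℕₚ.+-cancelˡ-≡ (suc k) _ r
  strict : suc n < suc m → n * suc n < m * suc m
  strict (s≤s n<m) = ℕₚ.*-mono-< n<m (s≤s n<m)

-- Sums over the ways of splitting a list into two complementary sublists.

module _ {A : Set} where

  Σsplits Σsplits⁺ : (List A → List A → ℕ) → List A → ℕ
  Σsplits f []       = f [] []
  Σsplits f (x ∷ xs) = Σsplits (λ ys zs → f (x ∷ ys) zs) xs + Σsplits (λ ys zs → f ys (x ∷ zs)) xs
  -- The splits whose second part is nonempty.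
  Σsplits⁺ f []       = 0
  Σsplits⁺ f (x ∷ xs) = Σsplits⁺ (λ ys zs → f (x ∷ ys) zs) xs + Σsplits (λ ys zs → f ys (x ∷ zs)) xs

  Σsplits-cong : ∀ {f g} → (∀ ys zs → f ys zs ≡ g ys zs) → ∀ xs → Σsplits f xs ≡ Σsplits g xs
  Σsplits-cong f≡g []       = f≡g [] []
  Σsplits-cong f≡g (x ∷ xs) =
    cong₂ _+_ (Σsplits-cong (λ ys → f≡g (x ∷ ys)) xs) (Σsplits-cong (λ ys zs → f≡g ys (x ∷ zs)) xs)

  Σsplits-+ : ∀ f g xs → Σsplits (λ ys zs → f ys zs + g ys zs) xs ≡ Σsplits f xs + Σsplits g xs
  Σsplits-+ f g []       = refl
  Σsplits-+ f g (x ∷ xs) =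
    trans (cong₂ _+_ (Σsplits-+ _ _ xs) (Σsplits-+ _ _ xs)) (interchange ℕₚ.+-commutativeSemigroup
      (Σsplits (λ ys → f (x ∷ ys)) xs) (Σsplits (λ ys → g (x ∷ ys)) xs) _ _)

  Σsplits-⁺ : ∀ f xs → Σsplits f xs ≡ f xs [] + Σsplits⁺ f xs
  Σsplits-⁺ f []       = sym (ℕₚ.+-identityʳ _)
  Σsplits-⁺ f (x ∷ xs) =
    trans (cong (_+ Σsplits (λ ys zs → f ys (x ∷ zs)) xs) (Σsplits-⁺ _ xs)) (ℕₚ.+-assoc (f (x ∷ xs) []) _ _)

  Σsplits-mono : ∀ {f g} xs → (∀ {ys zs} → Interleaving ys zs xs → f ys zs ≤ g ys zs) →
                 Σsplits f xs ≤ Σsplits g xs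
  Σsplits-mono []       f≤g = f≤g []
  Σsplits-mono (x ∷ xs) f≤g =
    ℕₚ.+-mono-≤ (Σsplits-mono xs (f≤g ∘ consˡ)) (Σsplits-mono xs (f≤g ∘ consʳ))

  -- Terms are compared only on actual splits of `xs` with a nonempty second part. The interleaving
  -- gives access to lengths and degrees of the parts. Once `x` is placed in the second part,
  -- nonemptiness is settled and `Σsplits-mono` takes over.
  Σsplits⁺-mono : ∀ {f g} xs →
                  (∀ {ys z zs} → Interleaving ys (z ∷ zs) xs → f ys (z ∷ zs) ≤ g ys (z ∷ zs)) →
                  Σsplits⁺ f xs ≤ Σsplits⁺ g xs
  Σsplits⁺-mono []       f≤g = z≤n
  Σsplits⁺-mono (x ∷ xs) f≤g =
    ℕₚ.+-mono-≤ (Σsplits⁺-mono xs (f≤g ∘ consˡ)) (Σsplits-mono xs (f≤g ∘ consʳ))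

-- Orientations of an edge list with prescribed net inflow.

module _ {n : ℕ} where

  Edge Flow : Set
  Edge = Fin n × Fin n
  Flow = Fin n → ℤ

  infixl 6 _⊕_ _⊖_
  _⊕_ _⊖_ : Flow → Flow → Flow
  (s ⊕ t) v = s v ℤ.+ t v
  (s ⊖ t) v = s v ℤ.- t v

  0ᶠ : Flow
  0ᶠ _ = 0ℤ

  δ : Fin n → Fin n → ℕ
  δ u v = 𝟙 (u ≟ v)

  χ : Edge → Flow
  χ (u , w) v = + δ w v ℤ.- + δ u v

  deg : List Edge → Flow
  deg []            v = 0ℤ
  deg ((u , w) ∷ L) v = + δ u v ℤ.+ + δ w v ℤ.+ deg L v

  isZero? : (s : Flow) → Dec (∀ v → s v ≡ 0ℤ)
  isZero? s = all? (λ v → s v ℤ.≟ 0ℤ)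

  -- The argument `s` is the net inflow still to be supplied: directing `e` as listed subtracts
  -- `χ e` from it, the reverse direction adds `χ e`, and it must vanish when no edge is left.
  #flow : List Edge → Flow → ℕ
  #flow []      s = 𝟙 (isZero? s)
  #flow (e ∷ L) s = #flow L (s ⊖ χ e) + #flow L (s ⊕ χ e)

  #flow-cong : ∀ L {s t} → s ≗ t → #flow L s ≡ #flow L t
  #flow-cong []      {s} {t} s≗t =
    𝟙-⇔ (mk⇔ (λ s0 v → trans (sym (s≗t v)) (s0 v)) (λ t0 v → trans (s≗t v) (t0 v))) (isZero? s) (isZero? t)
  #flow-cong (e ∷ L) s≗t =
    cong₂ _+_ (#flow-cong L (λ v → cong (ℤ._- χ e v) (s≗t v))) (#flow-cong L (λ v → cong (ℤ._+ χ e v) (s≗t v)))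

  -- For two orientations that agree on `A` and are opposite on `D`, let `a` be the common net
  -- inflow from `A` and `d` that of the first one from `D`. Their net inflows are `a + d` and
  -- `a - d`, and equating these with `s + t` and `s - t` forces `a = s` and `d = t`, since doubling
  -- is injective on the integers.
  #flow-⊕⊖ : ∀ L s t → #flow L (s ⊕ t) * #flow L (s ⊖ t) ≡ Σsplits (λ A D → #flow A s * #flow D t) L
  #flow-⊕⊖ [] s t = begin
    𝟙 (isZero? (s ⊕ t)) * 𝟙 (isZero? (s ⊖ t))     ≡⟨ 𝟙-× (isZero? (s ⊕ t)) (isZero? (s ⊖ t)) ⟨
    𝟙 (isZero? (s ⊕ t) ×-dec isZero? (s ⊖ t))
      ≡⟨ 𝟙-⇔ (mk⇔ to from) (isZero? (s ⊕ t) ×-dec isZero? (s ⊖ t)) (isZero? s ×-dec isZero? t) ⟩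
    𝟙 (isZero? s ×-dec isZero? t)                 ≡⟨ 𝟙-× (isZero? s) (isZero? t) ⟩
    𝟙 (isZero? s) * 𝟙 (isZero? t)                 ∎
    where
    open ≡-Reasoning
    sum : ∀ a b → a ℤ.+ a ≡ (a ℤ.+ b) ℤ.+ (a ℤ.- b)
    sum = solve-∀
    difference : ∀ a b → b ℤ.+ b ≡ (a ℤ.+ b) ℤ.- (a ℤ.- b)
    difference = solve-∀
    to : (∀ v → (s ⊕ t) v ≡ 0ℤ) × (∀ v → (s ⊖ t) v ≡ 0ℤ) → (∀ v → s v ≡ 0ℤ) × (∀ v → t v ≡ 0ℤ)
    to (s+t , s-t) =
      (λ v → i+i≡0⇒i≡0 (s v) (trans (sum (s v) (t v)) (cong₂ ℤ._+_ (s+t v) (s-t v)))) ,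
      (λ v → i+i≡0⇒i≡0 (t v) (trans (difference (s v) (t v)) (cong₂ ℤ._-_ (s+t v) (s-t v))))
    from : (∀ v → s v ≡ 0ℤ) × (∀ v → t v ≡ 0ℤ) → (∀ v → (s ⊕ t) v ≡ 0ℤ) × (∀ v → (s ⊖ t) v ≡ 0ℤ)
    from (s0 , t0) = (λ v → cong₂ ℤ._+_ (s0 v) (t0 v)) , (λ v → cong₂ ℤ._-_ (s0 v) (t0 v))
  #flow-⊕⊖ (e ∷ L) s t = begin
    (N (s ⊕ t ⊖ c) + N (s ⊕ t ⊕ c)) * (N (s ⊖ t ⊖ c) + N (s ⊖ t ⊕ c))
      ≡⟨ expand (N (s ⊕ t ⊖ c)) (N (s ⊕ t ⊕ c)) (N (s ⊖ t ⊖ c)) (N (s ⊖ t ⊕ c)) ⟩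
    (N (s ⊕ t ⊖ c) * N (s ⊖ t ⊖ c) + N (s ⊕ t ⊕ c) * N (s ⊖ t ⊕ c)) +
    (N (s ⊕ t ⊖ c) * N (s ⊖ t ⊕ c) + N (s ⊕ t ⊕ c) * N (s ⊖ t ⊖ c))
      -- In the first two products both orientations direct `e` alike, which shifts `s` and puts `e`
      -- into `A`; in the last two they direct it oppositely, which shifts `t` and puts `e` into
      -- `D`.
      ≡⟨ cong₂ _+_
           (cong₂ _+_ (product (s ⊖ c) t (λ v → p₁ (s v) (t v) (c v)) (λ v → p₂ (s v) (t v) (c v)))
                      (product (s ⊕ c) t (λ v → p₃ (s v) (t v) (c v)) (λ v → p₄ (s v) (t v) (c v))))
           (cong₂ _+_ (product s (t ⊖ c) (λ v → p₅ (s v) (t v) (c v)) (λ v → p₆ (s v) (t v) (c v)))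
                      (product s (t ⊕ c) (λ v → p₇ (s v) (t v) (c v)) (λ v → p₈ (s v) (t v) (c v)))) ⟩
    (Σsplits (F (s ⊖ c) t) L + Σsplits (F (s ⊕ c) t) L) + (Σsplits (F s (t ⊖ c)) L + Σsplits (F s (t ⊕ c)) L)
      ≡⟨ cong₂ _+_ (Σsplits-+ _ _ L) (Σsplits-+ _ _ L) ⟨
    Σsplits (λ A D → F (s ⊖ c) t A D + F (s ⊕ c) t A D) L + Σsplits (λ A D → F s (t ⊖ c) A D + F s (t ⊕ c) A D) L
      ≡⟨ cong₂ _+_
           (Σsplits-cong (λ A D → sym (ℕₚ.*-distribʳ-+ (#flow D t) (#flow A (s ⊖ c)) (#flow A (s ⊕ c)))) L)
           (Σsplits-cong (λ A D → sym (ℕₚ.*-distribˡ-+ (#flow A s) (#flow D (t ⊖ c)) (#flow D (t ⊕ c)))) L) ⟩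
    Σsplits (F s t) (e ∷ L) ∎
    where
    open ≡-Reasoning
    c : Flow
    c = χ e
    N : Flow → ℕ
    N = #flow L
    F : Flow → Flow → List Edge → List Edge → ℕ
    F s t A D = #flow A s * #flow D t
    product : ∀ s t {x y} → x ≗ s ⊕ t → y ≗ s ⊖ t → N x * N y ≡ Σsplits (F s t) L
    product s t x≗ y≗ = trans (cong₂ _*_ (#flow-cong L x≗) (#flow-cong L y≗)) (#flow-⊕⊖ L s t)
    expand : ∀ a b c d → (a + b) * (c + d) ≡ (a * c + b * d) + (a * d + b * c)
    expand = ℕ-Solver.solve-∀
    p₁ : ∀ a b c → a ℤ.+ b ℤ.- c ≡ a ℤ.- c ℤ.+ b
    p₁ = solve-∀
    p₂ : ∀ a b c → a ℤ.- b ℤ.- c ≡ a ℤ.- c ℤ.- b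
    p₂ = solve-∀
    p₃ : ∀ a b c → a ℤ.+ b ℤ.+ c ≡ a ℤ.+ c ℤ.+ b
    p₃ = solve-∀
    p₄ : ∀ a b c → a ℤ.- b ℤ.+ c ≡ a ℤ.+ c ℤ.- b
    p₄ = solve-∀
    p₅ : ∀ a b c → a ℤ.+ b ℤ.- c ≡ a ℤ.+ (b ℤ.- c)
    p₅ = solve-∀
    p₆ : ∀ a b c → a ℤ.- b ℤ.+ c ≡ a ℤ.- (b ℤ.- c)
    p₆ = solve-∀
    p₇ : ∀ a b c → a ℤ.+ b ℤ.+ c ≡ a ℤ.+ (b ℤ.+ c)
    p₇ = solve-∀
    p₈ : ∀ a b c → a ℤ.- b ℤ.- c ≡ a ℤ.- (b ℤ.+ c)
    p₈ = solve-∀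

  #flow² : ∀ L s → #flow L s * #flow L s ≡ #flow L s + Σsplits⁺ (λ A D → #flow A s * #flow D 0ᶠ) L
  #flow² L s = begin
    #flow L s * #flow L s
      ≡⟨ cong₂ _*_ (#flow-cong L (λ v → s+0 (s v))) (#flow-cong L (λ v → s-0 (s v))) ⟩
    #flow L (s ⊕ 0ᶠ) * #flow L (s ⊖ 0ᶠ)                           ≡⟨ #flow-⊕⊖ L s 0ᶠ ⟩
    Σsplits F L                                                   ≡⟨ Σsplits-⁺ F L ⟩
    #flow L s * 𝟙 (isZero? 0ᶠ) + Σsplits⁺ F L
      ≡⟨ cong (λ k → #flow L s * k + Σsplits⁺ F L) (𝟙-true (isZero? 0ᶠ) (λ _ → refl)) ⟩
    #flow L s * 1 + Σsplits⁺ F L                                  ≡⟨ cong (_+ Σsplits⁺ F L) (ℕₚ.*-identityʳ _) ⟩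
    #flow L s + Σsplits⁺ F L                                      ∎
    where
    open ≡-Reasoning
    F : List Edge → List Edge → ℕ
    F A D = #flow A s * #flow D 0ᶠ
    s+0 : ∀ a → a ≡ a ℤ.+ 0ℤ
    s+0 = solve-∀
    s-0 : ∀ a → a ≡ a ℤ.- 0ℤ
    s-0 = solve-∀

  -- Parity of degrees.

  EvenDegrees : List Edge → Set
  EvenDegrees L = ∀ v → + 2 ∣ deg L v

  -- An orientation counted by `#flow L s` has in-degree plus out-degree equal to `deg L` and
  -- in-degree minus out-degree equal to `s`, so the sum of the two is twice its in-degree.
  #flow≢0⇒2∣deg+s : ∀ L s → #flow L s ≢ 0 → ∀ v → + 2 ∣ deg L v ℤ.+ s v
  #flow≢0⇒2∣deg+s [] s s≢0 v = divides 0ℤ (cong (ℤ._+_ 0ℤ) (𝟙-≢0 (isZero? s) s≢0 v))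
  #flow≢0⇒2∣deg+s ((u , w) ∷ L) s s≢0 v
    with m+n≢0⇒m≢0⊎n≢0 (#flow L (s ⊖ χ (u , w))) _ s≢0
  ... | inj₁ nz = subst (+ 2 ∣_) (eq (+ δ u v) (+ δ w v) (deg L v) (s v))
                    (∣m∣n⇒∣m+n (#flow≢0⇒2∣deg+s L _ nz v) (divides (+ δ w v) refl))
    where
    eq : ∀ a b d x → (d ℤ.+ (x ℤ.- (b ℤ.- a))) ℤ.+ b ℤ.* + 2 ≡ a ℤ.+ b ℤ.+ d ℤ.+ x
    eq = solve-∀
  ... | inj₂ nz = subst (+ 2 ∣_) (eq (+ δ u v) (+ δ w v) (deg L v) (s v))
                    (∣m∣n⇒∣m+n (#flow≢0⇒2∣deg+s L _ nz v) (divides (+ δ u v) refl))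
    where
    eq : ∀ a b d x → (d ℤ.+ (x ℤ.+ (b ℤ.- a))) ℤ.+ a ℤ.* + 2 ≡ a ℤ.+ b ℤ.+ d ℤ.+ x
    eq = solve-∀

  deg-interleaving : ∀ {A D L} → Interleaving A D L → ∀ v → deg L v ≡ deg A v ℤ.+ deg D v
  deg-interleaving [] v = refl
  deg-interleaving {(a , b) ∷ A} {D} (consˡ sp) v =
    trans (cong (ℤ._+_ (+ δ a v ℤ.+ + δ b v)) (deg-interleaving sp v))
          (sym (ℤₚ.+-assoc (+ δ a v ℤ.+ + δ b v) (deg A v) (deg D v)))
  deg-interleaving {A} {(a , b) ∷ D} (consʳ sp) v =
    trans (cong (ℤ._+_ (+ δ a v ℤ.+ + δ b v)) (deg-interleaving sp v))
          (x∙yz≈y∙xz ℤₚ.+-commutativeSemigroup (+ δ a v ℤ.+ + δ b v) (deg A v) (deg D v))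

  EvenDegrees-complement : ∀ {A D L} → Interleaving A D L → EvenDegrees L → #flow D 0ᶠ ≢ 0 → EvenDegrees A
  EvenDegrees-complement {D = D} sp even nz v =
    ∣m+n∣n⇒∣m (subst (+ 2 ∣_) (deg-interleaving sp v) (even v))
              (subst (+ 2 ∣_) (ℤₚ.+-identityʳ _) (#flow≢0⇒2∣deg+s D 0ᶠ nz v))

  -- Existence of Eulerian orientations, by splitting off pairs of edges: edges
  -- ab and bw are replaced by the single edge aw.

  #flow-flip : ∀ u w L s → #flow ((u , w) ∷ L) s ≡ #flow ((w , u) ∷ L) s
  #flow-flip u w L s = trans (ℕₚ.+-comm (#flow L (s ⊖ χ (u , w))) _)
    (cong₂ _+_ (#flow-cong L (λ v → p (+ δ u v) (+ δ w v) (s v))) (#flow-cong L (λ v → q (+ δ u v) (+ δ w v) (s v))))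
    where
    p : ∀ a b x → x ℤ.+ (b ℤ.- a) ≡ x ℤ.- (a ℤ.- b)
    p = solve-∀
    q : ∀ a b x → x ℤ.- (b ℤ.- a) ≡ x ℤ.+ (a ℤ.- b)
    q = solve-∀

  #flow-swap : ∀ e f L s → #flow (e ∷ f ∷ L) s ≡ #flow (f ∷ e ∷ L) s
  #flow-swap e f L s = trans
    (interchange ℕₚ.+-commutativeSemigroup (#flow L (s ⊖ χ e ⊖ χ f)) _ _ _)
    (cong₂ _+_
      (cong₂ _+_ (#flow-cong L (λ v → p₁ (s v) (χ e v) (χ f v))) (#flow-cong L (λ v → p₂ (s v) (χ e v) (χ f v))))
      (cong₂ _+_ (#flow-cong L (λ v → p₃ (s v) (χ e v) (χ f v))) (#flow-cong L (λ v → p₄ (s v) (χ e v) (χ f v)))))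
    where
    p₁ : ∀ x a b → x ℤ.- a ℤ.- b ≡ x ℤ.- b ℤ.- a
    p₁ = solve-∀
    p₂ : ∀ x a b → x ℤ.+ a ℤ.- b ≡ x ℤ.- b ℤ.+ a
    p₂ = solve-∀
    p₃ : ∀ x a b → x ℤ.- a ℤ.+ b ≡ x ℤ.+ b ℤ.- a
    p₃ = solve-∀
    p₄ : ∀ x a b → x ℤ.+ a ℤ.+ b ≡ x ℤ.+ b ℤ.+ a
    p₄ = solve-∀

  -- Directing `ab` and `bw` consistently along the path from `a` to `w`, or both backwards, has the
  -- same net inflow as the corresponding direction of `aw`. The other two orientations of the pair
  -- are discarded.
  #flow-split-off : ∀ a b w L s → #flow ((a , w) ∷ L) s ≤ #flow ((a , b) ∷ (b , w) ∷ L) s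
  #flow-split-off a b w L s = ℕₚ.+-mono-≤
    (ℕₚ.≤-trans (ℕₚ.≤-reflexive (#flow-cong L (λ v → p (s v) (+ δ a v) (+ δ b v) (+ δ w v)))) (ℕₚ.m≤m+n _ _))
    (ℕₚ.≤-trans (ℕₚ.≤-reflexive (#flow-cong L (λ v → q (s v) (+ δ a v) (+ δ b v) (+ δ w v)))) (ℕₚ.m≤n+m _ _))
    where
    p : ∀ x a b w → x ℤ.- (w ℤ.- a) ≡ x ℤ.- (b ℤ.- a) ℤ.- (w ℤ.- b)
    p = solve-∀
    q : ∀ x a b w → x ℤ.+ (w ℤ.- a) ≡ x ℤ.+ (b ℤ.- a) ℤ.+ (w ℤ.- b)
    q = solve-∀

  #flow-loop : ∀ a L s → #flow L s ≤ #flow ((a , a) ∷ L) s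
  #flow-loop a L s = ℕₚ.≤-trans (ℕₚ.≤-reflexive (#flow-cong L (λ v → p (s v) (+ δ a v)))) (ℕₚ.m≤m+n _ _)
    where
    p : ∀ x a → x ≡ x ℤ.- (a ℤ.- a)
    p = solve-∀

  -- Stands in for equality up to reordering edges and exchanging their listed ends, keeping only
  -- the invariants that the existence proof uses.
  record _≃_ (L L′ : List Edge) : Set where
    field
      length-≡ : length L ≡ length L′
      deg-≗    : deg L ≗ deg L′
      #flow-≗  : #flow L ≗ #flow L′
  open _≃_

  -- An odd degree is nonzero, so some edge meets `b`; flips and swaps bring it to the front with
  -- `b` listed first.
  incidentEdge : ∀ b L → ¬ + 2 ∣ deg L b → ∃₂ λ w L′ → L ≃ ((b , w) ∷ L′)
  incidentEdge b [] odd = ⊥-elim (odd (divides 0ℤ refl))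
  incidentEdge b ((u , w) ∷ L) odd with u ≟ b | w ≟ b
  ... | yes refl | _        = w , L , record { length-≡ = refl ; deg-≗ = λ _ → refl ; #flow-≗ = λ _ → refl }
  ... | no _     | yes refl = u , L , record
    { length-≡ = refl
    ; deg-≗    = λ v → cong (ℤ._+ deg L v) (ℤₚ.+-comm (+ δ u v) (+ δ b v))
    ; #flow-≗  = #flow-flip u b L
    }
  ... | no _     | no _
    with incidentEdge b L (odd ∘ subst (+ 2 ∣_) (sym (ℤₚ.+-identityˡ _)))
  ...   | w′ , L′ , L≃ = w′ , (u , w) ∷ L′ , record
    { length-≡ = cong suc (length-≡ L≃)
    ; deg-≗    = λ v → trans (cong (ℤ._+_ (+ δ u v ℤ.+ + δ w v)) (deg-≗ L≃ v))
                             (x∙yz≈y∙xz ℤₚ.+-commutativeSemigroup (+ δ u v ℤ.+ + δ w v) (+ δ b v ℤ.+ + δ w′ v) (deg L′ v))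
    ; #flow-≗  = λ s → trans (cong₂ _+_ (#flow-≗ L≃ _) (#flow-≗ L≃ _)) (#flow-swap (u , w) (b , w′) L′ s)
    }

  -- A leading loop is dropped. Otherwise the leading edge `ab` is paired with another edge `bw`,
  -- and the pair is replaced by `aw`, which lowers the degree of `b` by two. The new list is one
  -- edge shorter but not a sublist, hence the induction on a length bound `k`.
  EvenDegrees⇒0<#flow : ∀ k L → length L ≤ k → EvenDegrees L → 1 ≤ #flow L 0ᶠ
  EvenDegrees⇒0<#flow k [] _ _ = ℕₚ.≤-reflexive (sym (𝟙-true (isZero? 0ᶠ) (λ _ → refl)))
  EvenDegrees⇒0<#flow (suc k) ((a , b) ∷ L) (s≤s len) even with a ≟ b
  ... | yes refl = ℕₚ.≤-trans
    (EvenDegrees⇒0<#flow k L len (λ v → ∣m+n∣m⇒∣n (even v) (divides (+ δ a v) (double (+ δ a v)))))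
    (#flow-loop a L 0ᶠ)
    where
    double : ∀ x → x ℤ.+ x ≡ x ℤ.* + 2
    double = solve-∀
  ... | no a≢b
    with incidentEdge b L odd
    where
    -- As `a` differs from `b`, the edge `ab` contributes exactly 1 to the even degree of `b`.
    odd : ¬ + 2 ∣ deg L b
    odd 2∣L with ∣m+n∣n⇒∣m {m = + δ a b ℤ.+ + δ b b} (even b) 2∣L
    ... | 2∣1 rewrite 𝟙-false (a ≟ b) a≢b | 𝟙-true (b ≟ b) refl = from-no (+ 2 ∣? + 1) 2∣1
  ... | w , L′ , L≃ = ℕₚ.≤-trans
    (ℕₚ.≤-trans
      (EvenDegrees⇒0<#flow k ((a , w) ∷ L′) (subst (_≤ k) (length-≡ L≃) len) even′)
      (#flow-split-off a b w L′ 0ᶠ))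
    (ℕₚ.≤-reflexive (sym (cong₂ _+_ (#flow-≗ L≃ _) (#flow-≗ L≃ _))))
    where
    eq : ∀ a b w d → a ℤ.+ b ℤ.+ (b ℤ.+ w ℤ.+ d) ≡ b ℤ.* + 2 ℤ.+ (a ℤ.+ w ℤ.+ d)
    eq = solve-∀
    even′ : EvenDegrees ((a , w) ∷ L′)
    even′ v = ∣m+n∣m⇒∣n
      (subst (+ 2 ∣_) (trans (cong (ℤ._+_ (+ δ a v ℤ.+ + δ b v)) (deg-≗ L≃ v))
                             (eq (+ δ a v) (+ δ b v) (+ δ w v) (deg L′ v))) (even v))
      (divides (+ δ b v) refl)

  -- Maximality at zero net inflow, by induction on the number of edges.

  #flow-max : ∀ k L → length L ≤ k → EvenDegrees L → ∀ s → #flow L s ≤ #flow L 0ᶠ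
  #flow-max k L len even s = m*m∸m-cancel-≤ (EvenDegrees⇒0<#flow k L len even)
    (#flow² L s) (#flow² L 0ᶠ) (Σsplits⁺-mono L (termwise k len))
    where
    termwise : ∀ k → length L ≤ k → ∀ {A d D} → Interleaving A (d ∷ D) L →
               #flow A s * #flow (d ∷ D) 0ᶠ ≤ #flow A 0ᶠ * #flow (d ∷ D) 0ᶠ
    termwise k len {A} {d} {D} sp with #flow (d ∷ D) 0ᶠ ℕₚ.≟ 0
    -- Here `A` may have odd degrees, but both products vanish.
    ... | yes z  rewrite z | ℕₚ.*-zeroʳ (#flow A s) = z≤n
    -- The edge `d` lies outside `A`, so `A` is strictly shorter than `L` and the bound can drop to
    -- `k′`.
    ... | no  nz with k | subst (_≤ k) (trans (interleave-length sp) (ℕₚ.+-suc _ _)) len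
    ...   | suc k′ | s≤s len′ = ℕₚ.*-monoˡ-≤ _
            (#flow-max k′ A (ℕₚ.m+n≤o⇒m≤o _ len′) (EvenDegrees-complement sp even nz) s)

-- Comparison of #flow with the counts of orientations of a graph.

length-filter-∷ : ∀ {A : Set} {P : A → Set} (P? : Decidable P) x xs →
                  length (filter P? (x ∷ xs)) ≡ 𝟙 (P? x) + length (filter P? xs)
length-filter-∷ P? x xs with does (P? x)
... | true  = refl
... | false = refl

length-filter-map : ∀ {A B : Set} {P : B → Set} (P? : Decidable P) (f : A → B) xs →
                    length (filter P? (map f xs)) ≡ length (filter (P? ∘ f) xs)
length-filter-map P? f []       = refl
length-filter-map P? f (x ∷ xs) = begin
  length (filter P? (f x ∷ map f xs))              ≡⟨ length-filter-∷ P? (f x) (map f xs) ⟩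
  𝟙 (P? (f x)) + length (filter P? (map f xs))     ≡⟨ cong (_+_ _) (length-filter-map P? f xs) ⟩
  𝟙 (P? (f x)) + length (filter (P? ∘ f) xs)       ≡⟨ length-filter-∷ (P? ∘ f) x xs ⟨
  length (filter (P? ∘ f) (x ∷ xs))                ∎
  where open ≡-Reasoning

countVecs : ∀ {m} {P : Vec Bool m → Set} → Decidable P → ℕ
countVecs P? = length (filter P? (allBoolVecs _))

countVecs-≐ : ∀ {m} {P Q : Vec Bool m → Set} (P? : Decidable P) (Q? : Decidable Q) →
              P ≐ Q → countVecs P? ≡ countVecs Q?
countVecs-≐ P? Q? P≐Q = cong length (filter-≐ P? Q? P≐Q (allBoolVecs _))

countVecs-suc : ∀ {m} {P : Vec Bool (suc m) → Set} (P? : Decidable P) →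
                countVecs P? ≡ countVecs (P? ∘ (true ∷_)) + countVecs (P? ∘ (false ∷_))
countVecs-suc {m} P? = begin
  length (filter P? (map (false ∷_) ws ++ map (true ∷_) ws ++ []))
    ≡⟨ cong (λ xs → length (filter P? (map (false ∷_) ws ++ xs))) (++-identityʳ _) ⟩
  length (filter P? (map (false ∷_) ws ++ map (true ∷_) ws))
    ≡⟨ cong length (filter-++ P? (map (false ∷_) ws) _) ⟩
  length (filter P? (map (false ∷_) ws) ++ filter P? (map (true ∷_) ws))
    ≡⟨ length-++ (filter P? (map (false ∷_) ws)) ⟩
  length (filter P? (map (false ∷_) ws)) + length (filter P? (map (true ∷_) ws))
    ≡⟨ cong₂ _+_ (length-filter-map P? (false ∷_) ws) (length-filter-map P? (true ∷_) ws) ⟩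
  countVecs (P? ∘ (false ∷_)) + countVecs (P? ∘ (true ∷_))
    -- The enumeration lists `false` first, whereas `#flow` counts the listed direction, the bit
    -- `true`, first.
    ≡⟨ ℕₚ.+-comm (countVecs (P? ∘ (false ∷_))) _ ⟩
  countVecs (P? ∘ (true ∷_)) + countVecs (P? ∘ (false ∷_)) ∎
  where
  open ≡-Reasoning
  ws : List (Vec Bool m)
  ws = allBoolVecs m

module _ {n : ℕ} where

  -- Together with `heads` and `tails`, this restates `#edges`, `head` and `tail` for edge families
  -- of any size, which allows induction on the number of edges. For a graph both versions agree by
  -- unfolding.
  tally : ∀ {m} → (Fin m → Fin n) → Fin n → ℕ
  tally {m} f v = length (filter (λ e → f e ≟ v) (allFin m))

  tally-suc : ∀ {m} (f : Fin (suc m) → Fin n) v → tally f v ≡ δ (f zero) v + tally (f ∘ suc) v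
  tally-suc {m} f v = begin
    length (filter (λ e → f e ≟ v) (zero ∷ tabulate suc))
      ≡⟨ length-filter-∷ (λ e → f e ≟ v) zero (tabulate suc) ⟩
    δ (f zero) v + length (filter (λ e → f e ≟ v) (tabulate suc))
      ≡⟨ cong (λ xs → δ (f zero) v + length (filter (λ e → f e ≟ v) xs)) (map-tabulate (λ e → e) suc) ⟨
    δ (f zero) v + length (filter (λ e → f e ≟ v) (map suc (allFin m)))
      ≡⟨ cong (_+_ _) (length-filter-map (λ e → f e ≟ v) suc (allFin m)) ⟩
    δ (f zero) v + tally (f ∘ suc) v ∎
    where open ≡-Reasoning

  heads tails : ∀ {m} → (Fin m → Edge {n}) → Vec Bool m → Fin m → Fin n
  heads ends o e = if lookup o e then proj₂ (ends e) else proj₁ (ends e)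
  tails ends o e = if lookup o e then proj₁ (ends e) else proj₂ (ends e)

  net : ∀ {m} → (Fin m → Edge) → Vec Bool m → Flow {n}
  net ends o v = + tally (heads ends o) v ℤ.- + tally (tails ends o) v

  net-∷ : ∀ {m} (ends : Fin (suc m) → Edge) b o v →
          net ends (b ∷ o) v ≡ (if b then χ (ends zero) v else ℤ.- χ (ends zero) v) ℤ.+ net (ends ∘ suc) o v
  net-∷ ends b o v = trans
    (cong₂ (λ x y → + x ℤ.- + y) (tally-suc (heads ends (b ∷ o)) v) (tally-suc (tails ends (b ∷ o)) v))
    (regroup b)
    where
    h t : ℤ
    h = + tally (heads (ends ∘ suc) o) v
    t = + tally (tails (ends ∘ suc) o) v
    p : ∀ a b x y → (b ℤ.+ x) ℤ.- (a ℤ.+ y) ≡ (b ℤ.- a) ℤ.+ (x ℤ.- y)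
    p = solve-∀
    q : ∀ a b x y → (a ℤ.+ x) ℤ.- (b ℤ.+ y) ≡ ℤ.- (b ℤ.- a) ℤ.+ (x ℤ.- y)
    q = solve-∀
    regroup : ∀ b →
      (+ δ (heads ends (b ∷ o) zero) v ℤ.+ h) ℤ.- (+ δ (tails ends (b ∷ o) zero) v ℤ.+ t) ≡
      (if b then χ (ends zero) v else ℤ.- χ (ends zero) v) ℤ.+ (h ℤ.- t)
    regroup true  = p (+ δ (proj₁ (ends zero)) v) (+ δ (proj₂ (ends zero)) v) h t
    regroup false = q (+ δ (proj₁ (ends zero)) v) (+ δ (proj₂ (ends zero)) v) h t

  hasNet? : ∀ {m} (ends : Fin m → Edge) (s : Flow) → Decidable (λ o → ∀ v → net ends o v ≡ s v)
  hasNet? ends s o = all? (λ v → net ends o v ℤ.≟ s v)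

  -- Once the first bit is fixed, the remaining edges must supply `s` minus the contribution of the
  -- first edge, which is `c` for `true` and its negative for `false`. This is the recursion of
  -- `#flow`.
  countVecs-hasNet : ∀ {m} (ends : Fin m → Edge) s → countVecs (hasNet? ends s) ≡ #flow (tabulate ends) s
  countVecs-hasNet {zero} ends s = begin
    countVecs (hasNet? ends s)      ≡⟨ length-filter-∷ (hasNet? ends s) [] [] ⟩
    𝟙 (hasNet? ends s []) + 0       ≡⟨ ℕₚ.+-identityʳ _ ⟩
    𝟙 (hasNet? ends s [])           ≡⟨ 𝟙-⇔ (mk⇔ (sym ∘_) (sym ∘_)) (hasNet? ends s []) (isZero? s) ⟩
    𝟙 (isZero? s)                   ∎
    where open ≡-Reasoning
  countVecs-hasNet {suc m} ends s = trans (countVecs-suc (hasNet? ends s))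
    (cong₂ _+_
      (trans (countVecs-≐ (hasNet? ends s ∘ (true ∷_)) (hasNet? (ends ∘ suc) (s ⊖ c))
               ( (λ {o} eq v → trans (p (c v) _) (cong (ℤ._- c v) (trans (sym (net-∷ ends true o v)) (eq v))))
               , (λ {o} eq v → trans (net-∷ ends true o v) (trans (cong (ℤ._+_ (c v)) (eq v)) (p′ (c v) (s v))))))
             (countVecs-hasNet (ends ∘ suc) (s ⊖ c)))
      (trans (countVecs-≐ (hasNet? ends s ∘ (false ∷_)) (hasNet? (ends ∘ suc) (s ⊕ c))
               ( (λ {o} eq v → trans (q (c v) _) (cong (ℤ._+ c v) (trans (sym (net-∷ ends false o v)) (eq v))))
               , (λ {o} eq v → trans (net-∷ ends false o v) (trans (cong (ℤ._+_ (ℤ.- c v)) (eq v)) (q′ (c v) (s v))))))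
             (countVecs-hasNet (ends ∘ suc) (s ⊕ c))))
    where
    c : Flow
    c = χ (ends zero)
    p : ∀ c x → x ≡ c ℤ.+ x ℤ.- c
    p = solve-∀
    p′ : ∀ c x → c ℤ.+ (x ℤ.- c) ≡ x
    p′ = solve-∀
    q : ∀ c x → x ≡ ℤ.- c ℤ.+ x ℤ.+ c
    q = solve-∀
    q′ : ∀ c x → ℤ.- c ℤ.+ (x ℤ.+ c) ≡ x
    q′ = solve-∀

  deg-tabulate : ∀ {m} (ends : Fin m → Edge) v →
                 deg (tabulate ends) v ≡ + (tally (proj₁ ∘ ends) v + tally (proj₂ ∘ ends) v)
  deg-tabulate {zero}  ends v = refl
  deg-tabulate {suc m} ends v = begin
    + (δ (proj₁ (ends zero)) v + δ (proj₂ (ends zero)) v) ℤ.+ deg (tabulate (ends ∘ suc)) v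
      ≡⟨ cong (ℤ._+_ (+ (δ (proj₁ (ends zero)) v + δ (proj₂ (ends zero)) v))) (deg-tabulate (ends ∘ suc) v) ⟩
    + ((δ (proj₁ (ends zero)) v + δ (proj₂ (ends zero)) v) +
       (tally (proj₁ ∘ ends ∘ suc) v + tally (proj₂ ∘ ends ∘ suc) v))
      ≡⟨ cong +_ (interchange ℕₚ.+-commutativeSemigroup (δ (proj₁ (ends zero)) v) _ _ _) ⟩
    + ((δ (proj₁ (ends zero)) v + tally (proj₁ ∘ ends ∘ suc) v) +
       (δ (proj₂ (ends zero)) v + tally (proj₂ ∘ ends ∘ suc) v))
      ≡⟨ cong₂ (λ x y → + (x + y)) (tally-suc (proj₁ ∘ ends) v) (tally-suc (proj₂ ∘ ends) v) ⟨
    + (tally (proj₁ ∘ ends) v + tally (proj₂ ∘ ends) v) ∎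
    where open ≡-Reasoning

  -- Whatever its bit, an edge has its two listed ends as head and tail in some order.
  tally-heads+tails : ∀ {m} (ends : Fin m → Edge) o v →
    tally (heads ends o) v + tally (tails ends o) v ≡ tally (proj₁ ∘ ends) v + tally (proj₂ ∘ ends) v
  tally-heads+tails {zero}  ends []      v = refl
  tally-heads+tails {suc m} ends (b ∷ o) v = begin
    tally (heads ends (b ∷ o)) v + tally (tails ends (b ∷ o)) v
      ≡⟨ cong₂ _+_ (tally-suc (heads ends (b ∷ o)) v) (tally-suc (tails ends (b ∷ o)) v) ⟩
    (δ (heads ends (b ∷ o) zero) v + _) + (δ (tails ends (b ∷ o) zero) v + _)
      ≡⟨ interchange ℕₚ.+-commutativeSemigroup (δ (heads ends (b ∷ o) zero) v) _ _ _ ⟩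
    (δ (heads ends (b ∷ o) zero) v + δ (tails ends (b ∷ o) zero) v) + _
      ≡⟨ cong₂ _+_ (ends-comm b) (tally-heads+tails (ends ∘ suc) o v) ⟩
    (δ (proj₁ (ends zero)) v + δ (proj₂ (ends zero)) v) + _
      ≡⟨ interchange ℕₚ.+-commutativeSemigroup (δ (proj₁ (ends zero)) v) _ _ _ ⟩
    (δ (proj₁ (ends zero)) v + _) + (δ (proj₂ (ends zero)) v + _)
      ≡⟨ cong₂ _+_ (tally-suc (proj₁ ∘ ends) v) (tally-suc (proj₂ ∘ ends) v) ⟨
    tally (proj₁ ∘ ends) v + tally (proj₂ ∘ ends) v ∎
    where
    open ≡-Reasoning
    ends-comm : ∀ b → δ (heads ends (b ∷ o) zero) v + δ (tails ends (b ∷ o) zero) v ≡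
                      δ (proj₁ (ends zero)) v + δ (proj₂ (ends zero)) v
    ends-comm true  = ℕₚ.+-comm (δ (proj₂ (ends zero)) v) _
    ends-comm false = refl

-- Transfer to the counts of a graph.

module _ (G : Graph) where
  open Graph G

  edges : List Edge
  edges = tabulate ends

  -- With in-degree `r` and total degree `d`, the out-degree is `d - r`, so the net inflow is
  -- `2r - d`.
  excess : (V → ℤ) → Flow
  excess r v = r v ℤ.+ r v ℤ.- + degree G v

  net-excess : ∀ o v → net ends o v ≡ excess (λ v → + inDegree G o v) v
  net-excess o v = trans (eq (+ inDegree G o v) (+ outDegree G o v))
    (cong (λ d → + inDegree G o v ℤ.+ + inDegree G o v ℤ.- + d) (tally-heads+tails ends o v))
    where
    eq : ∀ i j → i ℤ.- j ≡ i ℤ.+ i ℤ.- (i ℤ.+ j)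
    eq = solve-∀

  εᵣ≡#flow : ∀ r → εᵣ G r ≡ #flow edges (excess r)
  εᵣ≡#flow r = trans
    (countVecs-≐ (hasInDegrees? G r) (hasNet? ends (excess r))
      ( (λ {o} in≡r v → trans (net-excess o v) (cong (λ x → x ℤ.+ x ℤ.- + degree G v) (in≡r v)))
      , (λ {o} net≡ v → excess-injective (+ inDegree G o v) (r v) (+ degree G v) (trans (sym (net-excess o v)) (net≡ v)))))
    (countVecs-hasNet ends (excess r))
    where
    eq : ∀ x y d → (x ℤ.- y) ℤ.+ (x ℤ.- y) ≡ (x ℤ.+ x ℤ.- d) ℤ.- (y ℤ.+ y ℤ.- d)
    eq = solve-∀
    excess-injective : ∀ x y d → x ℤ.+ x ℤ.- d ≡ y ℤ.+ y ℤ.- d → x ≡ y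
    excess-injective x y d x≡y =
      ℤₚ.i-j≡0⇒i≡j x y (i+i≡0⇒i≡0 (x ℤ.- y) (trans (eq x y d) (ℤₚ.i≡j⇒i-j≡0 x≡y)))

  ε≡#flow : ε G ≡ #flow edges 0ᶠ
  ε≡#flow = trans
    (countVecs-≐ (isEulerianOrientation? G) (hasNet? ends 0ᶠ)
      ( (λ in≡out v → ℤₚ.i≡j⇒i-j≡0 (cong +_ (in≡out v)))
      , (λ net≡0 v → ℤₚ.+-injective (ℤₚ.i-j≡0⇒i≡j _ _ (net≡0 v)))))
    (countVecs-hasNet ends 0ᶠ)

  -- Halving an even degree is exact. Hence both bounds of the theorem compare with the same number,
  -- `#flow edges 0ᶠ`.
  excess-halfDegree : IsEulerian G → excess (halfDegree G) ≗ 0ᶠ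
  excess-halfDegree even v = ℤₚ.i≡j⇒i-j≡0 (cong +_ (trans (double (degree G v ℕ./ 2)) (ℕ.m/n*n≡m (even v))))
    where
    double : ∀ k → k + k ≡ k * 2
    double = ℕ-Solver.solve-∀

theorem1p11 : (G : Graph) → IsEulerian G →
    (r : Graph.V G → ℤ) →
    (εᵣ G r ≤ εᵣ G (halfDegree G)) × (εᵣ G r ≤ ε G)
theorem1p11 G even r =
  subst (εᵣ G r ≤_) (sym (trans (εᵣ≡#flow G (halfDegree G)) (#flow-cong L (excess-halfDegree G even)))) εᵣ≤ ,
  subst (εᵣ G r ≤_) (sym (ε≡#flow G)) εᵣ≤
  where
  L : List Edge
  L = edges G
  evenL : EvenDegrees L
  evenL v = subst (+ 2 ∣_) (sym (deg-tabulate (Graph.ends G) v)) (∣ᵤ⇒∣ (even v))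
  εᵣ≤ : εᵣ G r ≤ #flow L 0ᶠ
  εᵣ≤ = subst (_≤ #flow L 0ᶠ) (sym (εᵣ≡#flow G r)) (#flow-max (length L) L ℕₚ.≤-refl evenL (excess G r))
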